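{- Let $C$ be the capacity of the magazine and let $T_1,\dots,T_n$ be the sets of tools required for the jobs $1,\dots,n$. Run the algorithm GPCA on $(T_1,\dots,T_n;C)$ (with any choice of the enumeration orders it leaves free), let $q$ be the final value of its counter $pipes\_count$ and let $L=(L_1,\dots,L_n)$ be the final value of its sequence of states. Then: 1. $\displaystyle \min\{\mathrm{switches}(M): M\in\mathbf{M}\}=\sum_{i=1}^{n}|T_i|-C-q$. 2. The sequence obtained by applying the algorithm ToFullMag to $L$ (with any choice of its free enumeration orders) is an optimal solution of the Tool Loading Problem: $\mathrm{ToFullMag}(L)\in\operatorname{argmin}\{\mathrm{switches}(M): M\in\mathbf{M}\}$.
   Context: Setting (Tool Loading Problem). $T=\{1,\dots,m\}$ is the set of tools and $J=\{1,\dots,n\}$ the set of jobs, processed in the order $1,2,\dots,n$. Job $i$ needs the set of tools $T_i\subseteq T$. The magazine has capacity $C$, a positive integer. Standing assumptions: $\bigcup_{i=1}^n T_i=T$ (so $m=|\bigcup_{i=1}^n T_i|$), $|T_i|\le C$ for all $i$, and $C<m$. $\mathbf{M}=\{M=(M_1,\dots,M_n): M_i\subseteq T,\ T_i\subseteq M_i,\ |M_i|=C \text{ for all } i\in J\}$. For $M\in\mathbf{M}$, $\mathrm{switches}(M)=\sum_{i=1}^{n-1}|M_{i+1}\setminus M_i|$. Algorithm GPCA (Greedy Pipe Construction Algorithm), input $(T_1,\dots,T_n;C)$: Set $pipes\_count:=0$ and $M_i:=T_i$ for $i=1,\dots,n$. For $e=2,3,\dots,n$ in this order: let $candidates$ be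 the set of all triples $\pi_{s,e}^{t}=(s,e,t)$ with $1\le s<e$, $t\in T_s\cap T_e$ and $t\notin T_i$ for all $s<i<e$; go through the elements of $candidates$ one at a time in any order, and for each $\pi_{s,e}^t$, if (for the current states) $|M_i|<C$ for every $i$ with $s<i<e$, then add $t$ to each of $M_{s+1},\dots,M_{e-1}$ and increase $pipes\_count$ by $1$ (if $e=s+1$ the condition is vacuously true and only the counter changes). The output consists of the final $pipes\_count$ and the final sequence $(M_1,\dots,M_n)$. Algorithm ToFullMag, input a sequence of sets $(M_1,\dots,M_n)$ with $T_i\subseteq M_i\subseteq T$ and $|M_i|\le C$: for $(i,j)$ running successively through $(1,2),(2,3),\dots,(n-1,n),(n,n-1),(n-1,n-2),\dots,(2,1)$, go through the tools $t\in M_i$ one at a time in any order, and for each, if $t\notin M_j$ and currently $|M_j|<C$, replace $M_j$ by $M_j\cup\{t\}$. The output is the final sequence $(M_1,\dots,M_n)$. -}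

module Defs where

open import Data.Bool.Base using (if_then_else_)
open import Data.Fin.Base using (Fin; suc; inject₁; _<_)
open import Data.Fin.Properties using (_<?_; all?)
open import Data.Fin.Subset using (Subset; _∈_; _∉_; _⊆_; _∪_; _─_; ⁅_⁆; ∣_∣)
open import Data.Fin.Subset.Properties using (_∈?_)
open import Data.Integer.Base as ℤ using (ℤ; +_)
open import Data.List.Base using (List; []; _++_; map; foldl; drop; reverse; allFin)
import Data.List.Membership.Propositional as List
open import Data.List.Relation.Unary.Unique.Propositional using (Unique)
open import Data.Nat.Base as ℕ using (ℕ; zero; suc; _≤_)
open import Data.Nat.ListAction using (sum)
import Data.Nat.Properties as ℕ
open import Data.Product.Base using (_×_; _,_; ∃; swap)
open import Data.Vec.Functional using (Vector; updateAt)
open import Function.Bundles using (_⇔_)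
open import Relation.Binary.PropositionalEquality using (_≡_)
open import Relation.Nullary.Decidable using (Dec; does; ¬?; _×-dec_; _→-dec_)

-- Tools are elements of Fin m and jobs elements of Fin n, both numbered from 0.
-- A sequence of sets of tools indexed by the jobs is a Vector (Subset m) n.

-- The pairs (i , i + 1) of successive jobs, in increasing order.
consecutive : (n : ℕ) → List (Fin n × Fin n)
consecutive zero    = []
consecutive (suc k) = map (λ i → inject₁ i , suc i) (allFin k)

module _ {m n : ℕ} where

  record Feasible (T : Vector (Subset m) n) (C : ℕ) (M : Vector (Subset m) n) : Set where
    field
      required : ∀ i → T i ⊆ M i
      full     : ∀ i → ∣ M i ∣ ≡ C

  switches : Vector (Subset m) n → ℕ
  switches M = sum (map (λ (i , j) → ∣ M j ─ M i ∣) (consecutive n))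

-- v = min { f x : P x }, for a natural-valued f and an integer v; the value is
-- an integer so that it can be compared with a difference without truncation.
IsMinimum : {A : Set} → (A → Set) → (A → ℕ) → ℤ → Set
IsMinimum P f v = (∃ λ x → P x × + f x ≡ v) × (∀ x → P x → v ℤ.≤ + f x)

-- x ∈ argmin { f y : P y }
IsArgmin : {A : Set} → (A → Set) → (A → ℕ) → A → Set
IsArgmin P f x = P x × (∀ y → P y → f x ≤ f y)

-- The list goes through the elements satisfying P, each exactly once.
Enumerates : {A : Set} → (A → Set) → List A → Set
Enumerates P xs = Unique xs × (∀ x → x List.∈ xs ⇔ P x)

record Pipe (m n : ℕ) : Set where
  constructor pipe
  field
    start end : Fin n
    tool      : Fin m

open Pipe public

module _ {m n : ℕ} where

  Inside : Pipe m n → Fin n → Set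
  Inside π i = start π < i × i < end π

  inside? : (π : Pipe m n) (i : Fin n) → Dec (Inside π i)
  inside? π i = (start π <? i) ×-dec (i <? end π)

  record Candidate (T : Vector (Subset m) n) (e : Fin n) (π : Pipe m n) : Set where
    field
      ends-at    : end π ≡ e
      start<end  : start π < end π
      tool∈start : tool π ∈ T (start π)
      tool∈end   : tool π ∈ T (end π)
      tool∉inner : ∀ i → Inside π i → tool π ∉ T i

  -- The value of pipes_count together with the current sequence of states.
  GPCAState : Set
  GPCAState = ℕ × Vector (Subset m) n

  HasRoom : ℕ → Vector (Subset m) n → Pipe m n → Set
  HasRoom C M π = ∀ i → Inside π i → ∣ M i ∣ ℕ.< C

  hasRoom? : ∀ C M π → Dec (HasRoom C M π)
  hasRoom? C M π = all? (λ i → inside? π i →-dec (∣ M i ∣ ℕ.<? C))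

  insertPipe : Pipe m n → Vector (Subset m) n → Vector (Subset m) n
  insertPipe π M i = if does (inside? π i) then M i ∪ ⁅ tool π ⁆ else M i

  tryPipe : ℕ → GPCAState → Pipe m n → GPCAState
  tryPipe C (q , M) π =
    if does (hasRoom? C M π) then (suc q , insertPipe π M) else (q , M)

  -- The candidates ending at e depend on T and e only, so the free choices of a
  -- run amount to one list for each e.
  GPCAOrder : Vector (Subset m) n → (Fin n → List (Pipe m n)) → Set
  GPCAOrder T order = ∀ e → Enumerates (Candidate T e) (order e)

  -- drop 1 omits the first job, at which no pipe can end.
  gpca : Vector (Subset m) n → ℕ → (Fin n → List (Pipe m n)) → GPCAState
  gpca T C order =
    foldl (λ st e → foldl (tryPipe C) st (order e)) (0 , T) (drop 1 (allFin n))

  tryTool : ℕ → Fin n → Vector (Subset m) n → Fin m → Vector (Subset m) n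
  tryTool C j M t =
    if does (¬? (t ∈? M j) ×-dec (∣ M j ∣ ℕ.<? C))
    then updateAt M j (_∪ ⁅ t ⁆)
    else M

  -- The order in which the tools of M i are visited while processing (i , j).
  -- Every pair is processed once, and M i does not change meanwhile, so letting
  -- the order depend on i, j and the contents of M i covers every run.
  FillOrder : (Fin n → Fin n → Subset m → List (Fin m)) → Set
  FillOrder order = ∀ i j S → Enumerates (_∈ S) (order i j S)

  toFullMag : ℕ → (Fin n → Fin n → Subset m → List (Fin m)) →
              Vector (Subset m) n → Vector (Subset m) n
  toFullMag C order L =
    foldl (λ M (i , j) → foldl (tryTool C j) M (order i j (M i))) L
          (consecutive n ++ reverse (map swap (consecutive n)))

{-# OPTIONS --safe #-}
module Submission where

open import Defs
open import Algebra.Properties.CommutativeSemigroup using (interchange)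
open import Data.Bool.Base using (true; false; if_then_else_)
open import Data.Fin.Base as Fin using (Fin; zero; suc; inject₁; fromℕ)
import Data.Fin.Induction as Fin
import Data.Fin.Properties as Fin
open import Data.Fin.Subset using (Subset; inside; outside; ⋃; ⊤; ⊥; ∣_∣; ⁅_⁆; _∈_; _∉_; _⊆_; _∪_; _∩_; _─_)
open import Data.Fin.Subset.Properties hiding (⊆-refl; ⊆-trans)
open import Data.List.Base using (List; []; _∷_; concat; filter; foldl; length; map; tabulate; reverse; allFin)
open import Data.List.Properties using (filter-accept; filter-++; length-++; filter-none; foldl-++; map-tabulate; unfold-reverse)
import Data.List.Membership.Propositional as List
import Data.List.Membership.Propositional.Properties as List
open import Data.List.Relation.Binary.Permutation.Propositional using (_↭_; ↭-refl; ↭-sym; ↭-trans; prep) renaming (swap to ↭-swap)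
open import Data.List.Relation.Binary.Permutation.Propositional.Properties using (filter-↭; ↭-length; All-resp-↭)
open import Data.List.Relation.Binary.Sublist.Propositional using ([]; _∷_; _∷ʳ_; ⊆-refl; ⊆-trans) renaming (_⊆_ to _⊑_)
open import Data.List.Relation.Binary.Sublist.Propositional.Properties using (All-resp-⊆; filter-⊆)
open import Data.List.Relation.Unary.All as All using (All; []; _∷_)
import Data.List.Relation.Unary.All.Properties as All
open import Data.List.Relation.Unary.AllPairs as AllPairs using (AllPairs; []; _∷_)
import Data.List.Relation.Unary.AllPairs.Properties as AllPairs
open import Data.List.Relation.Unary.Any using (here; there)
import Data.List.Relation.Unary.Any.Properties as Any
import Data.List.Relation.Unary.Unique.Propositional.Properties as Unique
open import Data.Nat.Base using (ℕ; zero; suc; _+_; _≤_; _<_; z≤n; s≤s)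
open import Data.Nat.ListAction using (sum)
open import Data.Nat.Properties
open import Data.Product.Base using (_×_; _,_; ∃; ∃₂; proj₁; proj₂; swap)
open import Data.Sum.Base as Sum using (_⊎_; inj₁; inj₂; [_,_]′)
open import Data.Vec.Base using ([]; _∷_; here; there)
import Data.Vec.Functional as Vector
open Vector using (Vector; updateAt)
open import Data.Vec.Functional.Properties using (updateAt-minimal; updateAt-updates)
open import Function.Base using (_∘_; case_of_; flip; id)
open import Function.Bundles using (Equivalence; mk⇔)
open import Relation.Binary.Definitions using (tri<; tri≈; tri>)
open import Relation.Binary.PropositionalEquality using (_≡_; _≢_; refl; sym; trans; cong; cong₂; subst; subst₂)
open import Relation.Nullary.Decidable using (Dec; does; yes; no; dec-true; dec-false; ¬?; _×-dec_; _→-dec_)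
open import Relation.Nullary.Negation using (¬_; contradiction)

-- Say that a tool is inserted at job i if it is loaded at i but not at i − 1, the
-- magazine being empty at first.  A full sequence of states has C insertions at
-- the first job and then one for each switch.  Every use of a tool at which it is
-- not freshly inserted is the end of a pipe along which it was kept, so
-- insertions ≥ Σ |T i| − #pipes, and the question is how many pipes fit into
-- the magazine.  This is interval scheduling, for which taking pipes greedily by
-- right end is optimal even when the room varies from job to job: if an optimal
-- choice lacks the pipe just accepted, that pipe can replace the one of the
-- chosen pipes that starts first.  Conversely the result L of GPCA inserts tools
-- only where they are needed, so it attains the bound.  Filling forward keeps this
-- property; filling backward creates no new removals, and once all states are full,
-- removals and insertions balance.

private variable
  A : Set
  k m n : ℕ

-- Cardinalities of finite sets.

∈─⇒∉ : ∀ {x} (p q : Subset n) → x ∈ p ─ q → x ∉ q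
∈─⇒∉ (inside ∷ _)  (outside ∷ _) here ()
∈─⇒∉ (_ ∷ p)       (outside ∷ q) (there x∈p─q) (there x∈q) = ∈─⇒∉ p q x∈p─q x∈q
∈─⇒∉ (_ ∷ p)       (inside ∷ q)  (there x∈p─q) (there x∈q) = ∈─⇒∉ p q x∈p─q x∈q

∣p∪q∣+∣p∩q∣≡∣p∣+∣q∣ : ∀ (p q : Subset n) → ∣ p ∪ q ∣ + ∣ p ∩ q ∣ ≡ ∣ p ∣ + ∣ q ∣
∣p∪q∣+∣p∩q∣≡∣p∣+∣q∣ []            []            = refl
∣p∪q∣+∣p∩q∣≡∣p∣+∣q∣ (outside ∷ p) (outside ∷ q) = ∣p∪q∣+∣p∩q∣≡∣p∣+∣q∣ p q
∣p∪q∣+∣p∩q∣≡∣p∣+∣q∣ (inside  ∷ p) (outside ∷ q) = cong suc (∣p∪q∣+∣p∩q∣≡∣p∣+∣q∣ p q)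
∣p∪q∣+∣p∩q∣≡∣p∣+∣q∣ (outside ∷ p) (inside  ∷ q) =
  trans (cong suc (∣p∪q∣+∣p∩q∣≡∣p∣+∣q∣ p q)) (sym (+-suc ∣ p ∣ ∣ q ∣))
∣p∪q∣+∣p∩q∣≡∣p∣+∣q∣ (inside  ∷ p) (inside  ∷ q) = cong suc
  (trans (+-suc _ _) (trans (cong suc (∣p∪q∣+∣p∩q∣≡∣p∣+∣q∣ p q)) (sym (+-suc ∣ p ∣ ∣ q ∣))))

-- Inclusion-exclusion: the hypotheses amount to `p ∪ q ⊆ r ∪ s` and `p ∩ q ⊆ r ∩ s`. Nearly all
-- later counting goes through this multiplicity comparison; with `⊥` as one of the sets it also
-- bounds a disjoint union or splits a set.
∣p∣+∣q∣≤∣r∣+∣s∣ : ∀ (p q r s : Subset n) →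
  (∀ {x} → x ∈ p → x ∈ r ⊎ x ∈ s) →
  (∀ {x} → x ∈ q → x ∈ r ⊎ x ∈ s) →
  (∀ {x} → x ∈ p → x ∈ q → x ∈ r × x ∈ s) →
  ∣ p ∣ + ∣ q ∣ ≤ ∣ r ∣ + ∣ s ∣
∣p∣+∣q∣≤∣r∣+∣s∣ p q r s p⊆r∪s q⊆r∪s p∩q⊆r∩s =
  subst₂ _≤_ (∣p∪q∣+∣p∩q∣≡∣p∣+∣q∣ p q) (∣p∪q∣+∣p∩q∣≡∣p∣+∣q∣ r s)
    (+-mono-≤
      (p⊆q⇒∣p∣≤∣q∣ (λ x∈p∪q → x∈p∪q⁺ ([ p⊆r∪s , q⊆r∪s ]′ (x∈p∪q⁻ p q x∈p∪q))))
      (p⊆q⇒∣p∣≤∣q∣ (λ x∈p∩q → let x∈p , x∈q = x∈p∩q⁻ p q x∈p∩q in x∈p∩q⁺ (p∩q⊆r∩s x∈p x∈q))))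

∣p∣+∣⊥∣≡∣p∣ : ∀ (p : Subset n) → ∣ p ∣ + ∣ ⊥ {n = n} ∣ ≡ ∣ p ∣
∣p∣+∣⊥∣≡∣p∣ {n} p = trans (cong (∣ p ∣ +_) (∣⊥∣≡0 n)) (+-identityʳ _)

∣p∪⁅x⁆∣≤1+∣p∣ : ∀ (p : Subset n) x → ∣ p ∪ ⁅ x ⁆ ∣ ≤ suc ∣ p ∣
∣p∪⁅x⁆∣≤1+∣p∣ p x = begin
  ∣ p ∪ ⁅ x ⁆ ∣                      ≤⟨ m≤m+n _ _ ⟩
  ∣ p ∪ ⁅ x ⁆ ∣ + ∣ p ∩ ⁅ x ⁆ ∣      ≡⟨ ∣p∪q∣+∣p∩q∣≡∣p∣+∣q∣ p ⁅ x ⁆ ⟩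
  ∣ p ∣ + ∣ ⁅ x ⁆ ∣                  ≡⟨ cong (∣ p ∣ +_) (∣⁅x⁆∣≡1 x) ⟩
  ∣ p ∣ + 1                          ≡⟨ +-comm ∣ p ∣ 1 ⟩
  suc ∣ p ∣                          ∎
  where open ≤-Reasoning

length≤∣p∣ : (f : A → Fin n) (p : Subset n) {xs : List A} →
  AllPairs (λ x y → f x ≢ f y) xs → All (λ x → f x ∈ p) xs → length xs ≤ ∣ p ∣
length≤∣p∣ f p []            []             = z≤n
length≤∣p∣ f p (x∉xs ∷ xs!)  (fx∈p ∷ fxs∈p) = ≤-<-trans
  (length≤∣p∣ f (p ─ ⁅ f _ ⁆) xs!
    (All.zipWith (λ (fx≢fy , fy∈p) → x∈p∧x≢y⇒x∈p-y fy∈p (fx≢fy ∘ sym)) (x∉xs , fxs∈p)))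
  (x∈p⇒∣p-x∣<∣p∣ fx∈p)

∣p∣≤length : (f : A → Fin n) (p : Subset n) (xs : List A) →
  (∀ {i} → i ∈ p → ∃ λ x → x List.∈ xs × f x ≡ i) → ∣ p ∣ ≤ length xs
∣p∣≤length {n = n} f p [] p⊆xs = ≤-trans
  (p⊆q⇒∣p∣≤∣q∣ {q = ⊥} (λ i∈p → case p⊆xs i∈p of λ ()))
  (≤-reflexive (∣⊥∣≡0 n))
∣p∣≤length f p (x ∷ xs) p⊆xs = begin
  ∣ p ∣                          ≤⟨ p⊆q⇒∣p∣≤∣q∣ p⊆p-fx∪fx ⟩
  ∣ (p ─ ⁅ f x ⁆) ∪ ⁅ f x ⁆ ∣    ≤⟨ ∣p∪⁅x⁆∣≤1+∣p∣ (p ─ ⁅ f x ⁆) (f x) ⟩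
  suc ∣ p ─ ⁅ f x ⁆ ∣            ≤⟨ s≤s (∣p∣≤length f (p ─ ⁅ f x ⁆) xs p-fx⊆xs) ⟩
  suc (length xs)                ∎
  where
  open ≤-Reasoning
  p⊆p-fx∪fx : p ⊆ (p ─ ⁅ f x ⁆) ∪ ⁅ f x ⁆
  p⊆p-fx∪fx {i} i∈p with i Fin.≟ f x
  ... | yes refl  = q⊆p∪q (p ─ ⁅ f x ⁆) _ (x∈⁅x⁆ i)
  ... | no  i≢fx  = p⊆p∪q _ (x∈p∧x≢y⇒x∈p-y i∈p i≢fx)
  p-fx⊆xs : ∀ {i} → i ∈ p ─ ⁅ f x ⁆ → ∃ λ y → y List.∈ xs × f y ≡ i
  p-fx⊆xs i∈p-fx with p⊆xs (p─q⊆p p ⁅ f x ⁆ i∈p-fx)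
  ... | _ , here refl  , refl = contradiction (x∈⁅x⁆ (f x)) (∈─⇒∉ p ⁅ f x ⁆ i∈p-fx)
  ... | y , there y∈xs , fy≡i = y , y∈xs , fy≡i

length-filter-∷ : ∀ {P : A → Set} (P? : ∀ x → Dec (P x)) x xs →
  length (filter P? xs) ≤ length (filter P? (x ∷ xs))
length-filter-∷ P? x xs with does (P? x)
... | true  = n≤1+n _
... | false = ≤-refl

-- Finite sums.

Σ : (Fin n → ℕ) → ℕ
Σ f = sum (tabulate f)

Σ-mono : {f g : Fin n → ℕ} → (∀ i → f i ≤ g i) → Σ f ≤ Σ g
Σ-mono {zero}  f≤g = z≤n
Σ-mono {suc n} f≤g = +-mono-≤ (f≤g zero) (Σ-mono (f≤g ∘ suc))

Σ-+ : (f g : Fin n → ℕ) → Σ (λ i → f i + g i) ≡ Σ f + Σ g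
Σ-+ {zero}  f g = refl
Σ-+ {suc n} f g = trans (cong (f zero + g zero +_) (Σ-+ (f ∘ suc) (g ∘ suc)))
  (interchange +-commutativeSemigroup (f zero) (g zero) (Σ (f ∘ suc)) (Σ (g ∘ suc)))

-- φ is the potential of an amortised cost argument.
Σ-telescope : ∀ {n} (f g : Fin n → ℕ) (φ : Fin (suc n) → ℕ) →
  (∀ i → f i + φ (suc i) ≤ g i + φ (inject₁ i)) → Σ f + φ (Fin.fromℕ n) ≤ Σ g + φ zero
Σ-telescope {zero}  f g φ step = ≤-refl
Σ-telescope {suc n} f g φ step = begin
  f zero + Σ (f ∘ suc) + φ (Fin.fromℕ (suc n))    ≡⟨ +-assoc (f zero) _ _ ⟩
  f zero + (Σ (f ∘ suc) + φ (Fin.fromℕ (suc n)))  ≤⟨ +-monoʳ-≤ (f zero) (Σ-telescope (f ∘ suc) (g ∘ suc) (φ ∘ suc) (step ∘ suc)) ⟩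
  f zero + (Σ (g ∘ suc) + φ (suc zero))           ≡⟨ cong (f zero +_) (+-comm _ (φ (suc zero))) ⟩
  f zero + (φ (suc zero) + Σ (g ∘ suc))           ≡⟨ +-assoc (f zero) _ _ ⟨
  f zero + φ (suc zero) + Σ (g ∘ suc)             ≤⟨ +-monoˡ-≤ _ (step zero) ⟩
  g zero + φ zero + Σ (g ∘ suc)                   ≡⟨ +-assoc (g zero) _ _ ⟩
  g zero + (φ zero + Σ (g ∘ suc))                 ≡⟨ cong (g zero +_) (+-comm (φ zero) _) ⟩
  g zero + (Σ (g ∘ suc) + φ zero)                 ≡⟨ +-assoc (g zero) _ _ ⟨
  g zero + Σ (g ∘ suc) + φ zero                   ∎
  where open ≤-Reasoning

-- Greedy interval scheduling with varying room.

insertPipe-inside : ∀ (π : Pipe m n) M {i} → Inside π i → insertPipe π M i ≡ M i ∪ ⁅ tool π ⁆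
insertPipe-inside π M {i} in-i rewrite dec-true (inside? π i) in-i = refl

insertPipe-outside : ∀ (π : Pipe m n) M {i} → ¬ Inside π i → insertPipe π M i ≡ M i
insertPipe-outside π M {i} ¬in-i rewrite dec-false (inside? π i) ¬in-i = refl

tryPipe-accept : ∀ {C q M} {π : Pipe m n} → HasRoom C M π → tryPipe C (q , M) π ≡ (suc q , insertPipe π M)
tryPipe-accept {C = C} {M = M} {π} room rewrite dec-true (hasRoom? C M π) room = refl

tryPipe-reject : ∀ {C q M} {π : Pipe m n} → ¬ HasRoom C M π → tryPipe C (q , M) π ≡ (q , M)
tryPipe-reject {C = C} {M = M} {π} ¬room rewrite dec-false (hasRoom? C M π) ¬room = refl

cover : List (Pipe m n) → Fin n → ℕ
cover πs i = length (filter (λ π → inside? π i) πs)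

cover-inside : ∀ (π : Pipe m n) {πs} i → Inside π i → cover (π ∷ πs) i ≡ suc (cover πs i)
cover-inside π i in-i = cong length (filter-accept (λ π → inside? π i) in-i)

cover-∷ : ∀ (π : Pipe m n) πs i → cover πs i ≤ cover (π ∷ πs) i
cover-∷ π πs i = length-filter-∷ (λ π → inside? π i) π πs

-- The remainder is described twice: up to permutation, since loads and lengths do not see the
-- order, and as a sublist, since the greedy induction needs it in candidate order.
leftmost : ∀ (σ : Pipe m n) σs → ∃₂ λ μ μs →
  (σ ∷ σs ↭ μ ∷ μs) × (μs ⊑ σ ∷ σs) × All (λ τ → start μ Fin.≤ start τ) μs
leftmost σ []       = σ , [] , ↭-refl , σ ∷ʳ [] , []
leftmost σ (τ ∷ τs) with leftmost τ τs
... | μ , μs , perm , sub , least with Fin.≤-total (start σ) (start μ)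
... | inj₁ σ≤μ = σ , τ ∷ τs , ↭-refl , σ ∷ʳ ⊆-refl ,
  All-resp-↭ (↭-sym perm) (σ≤μ ∷ All.map (≤-trans σ≤μ) least)
... | inj₂ μ≤σ = μ , σ ∷ μs , ↭-trans (prep σ perm) (↭-swap σ μ ↭-refl) , refl ∷ sub , μ≤σ ∷ least

module _ {m n : ℕ} (C : ℕ) where

  -- Every pipe is charged one place at each of its inner jobs, even if its tool is already loaded
  -- there, so the scheduling argument need not know which tools the pipes carry.
  Fits : Vector (Subset m) n → List (Pipe m n) → Set
  Fits M πs = ∀ i → ∣ M i ∣ + cover πs i ≤ C

  insertPipe-load : ∀ (π : Pipe m n) M i {k} → (Inside π i → suc ∣ M i ∣ + k ≤ C) →
    ∣ M i ∣ + k ≤ C → ∣ insertPipe π M i ∣ + k ≤ C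
  insertPipe-load π M i in-fits fits with inside? π i
  ... | yes in-i rewrite insertPipe-inside π M in-i =
    ≤-trans (+-monoˡ-≤ _ (∣p∪⁅x⁆∣≤1+∣p∣ (M i) (tool π))) (in-fits in-i)
  ... | no ¬in-i rewrite insertPipe-outside π M ¬in-i = fits

  Fits-∷ : ∀ M {πs} (π : Pipe m n) → Fits M (π ∷ πs) →
    ∀ i → Inside π i → suc ∣ M i ∣ + cover πs i ≤ C
  Fits-∷ M π fits i in-i = ≤-trans
    (≤-reflexive (trans (sym (+-suc ∣ M i ∣ _)) (cong (∣ M i ∣ +_) (sym (cover-inside π i in-i)))))
    (fits i)

  Fits-tail : ∀ M {πs} (π : Pipe m n) → Fits M (π ∷ πs) → Fits M πs
  Fits-tail M π fits i = ≤-trans (+-monoʳ-≤ ∣ M i ∣ (cover-∷ π _ i)) (fits i)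

  -- Among the pipes of σ ∷ σs, which all end after π, the one that starts first
  -- runs through every job inside π that any of them runs through, so it can be
  -- traded for π.
  exchange : ∀ {M σ σs} (π : Pipe m n) → HasRoom C M π →
    All (λ τ → end π Fin.≤ end τ) (σ ∷ σs) → Fits M (σ ∷ σs) →
    ∃ λ μs → (μs ⊑ σ ∷ σs) × length μs ≡ length σs × Fits (insertPipe π M) μs
  exchange {M} {σ} {σs} π room π≤σs fits with leftmost σ σs
  ... | μ , μs , perm , sub , least =
    μs , sub , suc-injective (sym (↭-length perm)) ,
    λ i → insertPipe-load π M i (inner i) (Fits-tail M μ fits-μ i)
    where
    fits-μ : Fits M (μ ∷ μs)
    fits-μ i = subst (λ k → ∣ M i ∣ + k ≤ C) (↭-length (filter-↭ (λ τ → inside? τ i) perm)) (fits i)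
    inner : ∀ i → Inside π i → suc ∣ M i ∣ + cover μs i ≤ C
    inner i (π<i , i<π) with inside? μ i
    ... | yes in-μ = Fits-∷ M μ fits-μ i in-μ
    ... | no ¬in-μ = ≤-trans
      (≤-reflexive (trans
        (cong (λ πs → suc ∣ M i ∣ + length πs) (filter-none (λ τ → inside? τ i) (All.map (λ {τ} → ¬in-τ {τ}) least)))
        (+-identityʳ _)))
      (room i (π<i , i<π))
      where
      ¬in-τ : ∀ {τ : Pipe m n} → start μ Fin.≤ start τ → ¬ Inside τ i
      ¬in-τ μ≤τ (τ<i , _) =
        ¬in-μ (≤-<-trans μ≤τ τ<i , <-≤-trans i<π (All.head (All-resp-↭ perm π≤σs)))

  -- Induction along the candidates, with `σs` a rival choice among those still to come. If `π` is a
  -- rival, there is room for it and it is accepted; if `π` is rejected, it was no rival and nothing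
  -- changes; if a `π` outside `σs` is accepted, `exchange` gives up one rival for the one gained,
  -- or none when no rival is left.
  greedy-optimal : ∀ {πs σs} → AllPairs (λ π σ → end π Fin.≤ end σ) πs → σs ⊑ πs →
    ∀ q M → Fits M σs → q + length σs ≤ proj₁ (foldl (tryPipe C) (q , M) πs)
  greedy-optimal [] [] q M fits = ≤-reflexive (+-identityʳ q)
  greedy-optimal {π ∷ _} (_ ∷ sorted) (refl ∷ sub) q M fits
    rewrite tryPipe-accept {C = C} {q} {M} {π} (λ i in-i → m+n≤o⇒m≤o _ (Fits-∷ M π fits i in-i))
    = ≤-trans (≤-reflexive (+-suc q _)) (greedy-optimal sorted sub (suc q) (insertPipe π M)
        (λ i → insertPipe-load π M i (Fits-∷ M π fits i) (Fits-tail M π fits i)))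
  greedy-optimal {π ∷ _} (π≤πs ∷ sorted) (_ ∷ʳ sub) q M fits with hasRoom? C M π
  ... | no ¬room rewrite tryPipe-reject {C = C} {q} {M} {π} ¬room = greedy-optimal sorted sub q M fits
  greedy-optimal {π ∷ _} {[]} (_ ∷ sorted) (_ ∷ʳ sub) q M fits | yes room
    rewrite tryPipe-accept {C = C} {q} {M} {π} room
    = ≤-trans (n≤1+n _) (greedy-optimal sorted sub (suc q) (insertPipe π M)
        (λ i → insertPipe-load π M i (λ in-i → subst (_≤ C) (sym (+-identityʳ _)) (room i in-i)) (fits i)))
  greedy-optimal {π ∷ _} {_ ∷ _} (π≤πs ∷ sorted) (_ ∷ʳ sub) q M fits | yes room
    rewrite tryPipe-accept {C = C} {q} {M} {π} room
    with exchange π room (All-resp-⊆ sub π≤πs) fits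
  ... | μs , μs⊑σs , ∣μs∣≡∣σs∣ , fits′ = ≤-trans
    (≤-reflexive (trans (+-suc q _) (cong (suc q +_) (sym ∣μs∣≡∣σs∣))))
    (greedy-optimal sorted (⊆-trans μs⊑σs sub) (suc q) (insertPipe π M) fits′)

-- Insertions, reuse and lazy sequences.

-- The magazine counts as empty before the first job.
before : Vector (Subset m) n → Vector (Subset m) n
before M i = (⊥ Vector.∷ M) (inject₁ i)

infix 4 _⊆̇_

_⊆̇_ : Vector (Subset m) n → Vector (Subset m) n → Set
M ⊆̇ N = ∀ i → M i ⊆ N i

before-mono : ∀ {M N : Vector (Subset m) n} → M ⊆̇ N → before M ⊆̇ before N
before-mono M⊆N zero    = id
before-mono M⊆N (suc i) = M⊆N (inject₁ i)

insertions : Vector (Subset m) n → ℕ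
insertions M = Σ (λ i → ∣ M i ─ before M i ∣)

-- Equivalent to `M i ─ before M i ⊆ T i`, insertion on demand only; the disjunction is the form in
-- which a tool is traced back in time.
Lazy : Vector (Subset m) n → Vector (Subset m) n → Set
Lazy T M = ∀ i {t} → t ∈ M i → t ∈ T i ⊎ t ∈ before M i

-- When `M` is lazy and contains `T`, this is the number of pipes contained in `M`.
reused : Vector (Subset m) n → Vector (Subset m) n → ℕ
reused T M = Σ (λ i → ∣ T i ∩ before M i ∣)

-- At each job the inserted tools lie in `T i` by laziness, and they are disjoint from the reused
-- ones, which were loaded before.
insertions+reused≤ : ∀ {T M : Vector (Subset m) n} → Lazy T M →
  insertions M + reused T M ≤ Σ (λ i → ∣ T i ∣)
insertions+reused≤ {T = T} {M} lazy = ≤-trans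
  (≤-reflexive (sym (Σ-+ (λ i → ∣ M i ─ before M i ∣) _)))
  (Σ-mono λ i → ≤-trans
    (∣p∣+∣q∣≤∣r∣+∣s∣ (M i ─ before M i) (T i ∩ before M i) (T i) ⊥
      (λ x∈M─b → case lazy i (p─q⊆p (M i) _ x∈M─b) of λ where
        (inj₁ x∈T) → inj₁ x∈T
        (inj₂ x∈b) → contradiction x∈b (∈─⇒∉ (M i) _ x∈M─b))
      (inj₁ ∘ p∩q⊆p (T i) _)
      (λ x∈M─b x∈T∩b → contradiction (p∩q⊆q (T i) _ x∈T∩b) (∈─⇒∉ (M i) _ x∈M─b)))
    (≤-reflexive (∣p∣+∣⊥∣≡∣p∣ (T i))))

-- Removes from every state the tools that have not been used since they were
-- last inserted; S is the trimmed state before the first job.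
trimFrom : Subset m → Vector (Subset m) n → Vector (Subset m) n → Vector (Subset m) n
trimFrom S T M zero    = T zero ∪ (S ∩ M zero)
trimFrom S T M (suc i) = trimFrom (trimFrom S T M zero) (T ∘ suc) (M ∘ suc) i

-- The definition recurses by shifting the sequence; membership arguments need the local recurrence
-- at `i`, whose bracket is `before` of the trimmed sequence when `S` is `⊥`.
trimFrom-step : ∀ (S : Subset m) (T M : Vector (Subset m) n) i →
  trimFrom S T M i ≡ T i ∪ ((S Vector.∷ trimFrom S T M) (inject₁ i) ∩ M i)
trimFrom-step S T M zero          = refl
trimFrom-step S T M (suc zero)    = refl
trimFrom-step S T M (suc (suc i)) = trimFrom-step _ (T ∘ suc) (M ∘ suc) (suc i)

module _ (T M : Vector (Subset m) n) where

  trim : Vector (Subset m) n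
  trim = trimFrom ⊥ T M

  ∈trim⁻ : ∀ i {t} → t ∈ trim i → t ∈ T i ⊎ (t ∈ before trim i × t ∈ M i)
  ∈trim⁻ i t∈A = Sum.map₂ (x∈p∩q⁻ _ (M i))
    (x∈p∪q⁻ (T i) _ (subst (_ ∈_) (trimFrom-step ⊥ T M i) t∈A))

  ∈trim⁺ : ∀ i {t} → t ∈ T i ⊎ (t ∈ before trim i × t ∈ M i) → t ∈ trim i
  ∈trim⁺ i t∈ = subst (_ ∈_) (sym (trimFrom-step ⊥ T M i)) (x∈p∪q⁺ (Sum.map₂ x∈p∩q⁺ t∈))

  trim-lazy : Lazy T trim
  trim-lazy i = Sum.map₂ proj₁ ∘ ∈trim⁻ i

  T⊆trim : T ⊆̇ trim
  T⊆trim i = ∈trim⁺ i ∘ inj₁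

  trim⊆M : T ⊆̇ M → trim ⊆̇ M
  trim⊆M T⊆M i = [ T⊆M i , proj₂ ]′ ∘ ∈trim⁻ i

  -- Each use that the trimmed sequence has to load anew is charged to an insertion of `M` at that
  -- job or earlier. The potential is zero at the start, and its final value is dropped.
  Σ∣T─trim∣≤insertions : T ⊆̇ M → Σ (λ i → ∣ T i ─ before trim i ∣) ≤ insertions M
  Σ∣T─trim∣≤insertions T⊆M = ≤-trans (m≤m+n _ _) (≤-trans
    (Σ-telescope (λ i → ∣ T i ─ before trim i ∣) (λ i → ∣ M i ─ before M i ∣) unused step)
    (≤-reflexive (trans
      (cong (insertions M +_) (trans (cong ∣_∣ (p─⊥≡p {n = m} ⊥)) (∣⊥∣≡0 m)))
      (+-identityʳ _))))
    where
    -- The potential: tools that `M` carries without a use since their insertion.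
    unused : Fin (suc n) → ℕ
    unused j = ∣ (⊥ Vector.∷ M) j ─ (⊥ Vector.∷ trim) j ∣
    split : ∀ i {t} → t ∈ M i → t ∉ before trim i →
      t ∈ M i ─ before M i ⊎ t ∈ before M i ─ before trim i
    split i {t} t∈M t∉b with t ∈? before M i
    ... | yes t∈bM = inj₂ (x∈p∧x∉q⇒x∈p─q t∈bM t∉b)
    ... | no  t∉bM = inj₁ (x∈p∧x∉q⇒x∈p─q t∈M t∉bM)
    step : ∀ i → ∣ T i ─ before trim i ∣ + ∣ M i ─ trim i ∣ ≤ ∣ M i ─ before M i ∣ + ∣ before M i ─ before trim i ∣
    step i = ∣p∣+∣q∣≤∣r∣+∣s∣ _ _ _ _
      (λ t∈ → split i (T⊆M i (p─q⊆p (T i) _ t∈)) (∈─⇒∉ (T i) _ t∈))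
      (λ t∈ → let t∈M = p─q⊆p (M i) _ t∈ in
        split i t∈M (λ t∈b → ∈─⇒∉ (M i) _ t∈ (∈trim⁺ i (inj₂ (t∈b , t∈M)))))
      (λ t∈T─b t∈M─A → contradiction (T⊆trim i (p─q⊆p (T i) _ t∈T─b)) (∈─⇒∉ (M i) _ t∈M─A))

Σ∣T∣≤ : (T A : Vector (Subset m) n) →
  Σ (λ i → ∣ T i ∣) ≤ Σ (λ i → ∣ T i ─ before A i ∣) + reused T A
Σ∣T∣≤ T A = ≤-trans
  (Σ-mono λ i → ≤-trans (m≤m+n _ _) (∣p∣+∣q∣≤∣r∣+∣s∣ (T i) ⊥ (T i ─ before A i) (T i ∩ before A i)
    (λ {x} x∈T → case x ∈? before A i of λ where
      (yes x∈b) → inj₂ (x∈p∩q⁺ (x∈T , x∈b))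
      (no  x∉b) → inj₁ (x∈p∧x∉q⇒x∈p─q x∈T x∉b))
    (λ x∈⊥ → contradiction x∈⊥ ∉⊥)
    (λ _ x∈⊥ → contradiction x∈⊥ ∉⊥)))
  (≤-reflexive (Σ-+ (λ i → ∣ T i ─ before A i ∣) _))

-- Pipes contained in a sequence, and reuse.

Contained : Vector (Subset m) n → Pipe m n → Set
Contained M π = ∀ i → Inside π i → tool π ∈ M i

contained? : (M : Vector (Subset m) n) (π : Pipe m n) → Dec (Contained M π)
contained? M π = Fin.all? (λ i → inside? π i →-dec (tool π ∈? M i))

-- Leaves the end free, so that candidates ending at different jobs can be compared.
IsPipe : Vector (Subset m) n → Pipe m n → Set
IsPipe T π = Candidate T (end π) π

<suc⇒≤inject₁ : ∀ {i : Fin (suc n)} {j : Fin n} → i Fin.< suc j → i Fin.≤ inject₁ j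
<suc⇒≤inject₁ {j = j} (s≤s i≤j) = ≤-trans i≤j (≤-reflexive (sym (Fin.toℕ-inject₁ j)))

inject₁<suc : ∀ (i : Fin n) → inject₁ i Fin.< suc i
inject₁<suc i = s≤s (≤-reflexive (Fin.toℕ-inject₁ i))

tool∈before : ∀ {T M : Vector (Subset m) n} {π} → T ⊆̇ M → IsPipe T π → Contained M π →
  ∀ i → start π Fin.< i → i Fin.≤ end π → tool π ∈ before M i
tool∈before {π = π} T⊆M isPipe π⊆M (suc i) π<i i≤π with Fin.<-cmp (start π) (inject₁ i)
... | tri< π<i′ _ _ = π⊆M (inject₁ i) (π<i′ , <-≤-trans (inject₁<suc i) i≤π)
... | tri≈ _ refl _ = T⊆M (inject₁ i) (Candidate.tool∈start isPipe)
... | tri> _ _ π>i′ = contradiction (<suc⇒≤inject₁ π<i) (<⇒≱ π>i′)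

-- If e needs t as well, then (s , e , t) is a pipe along which t is kept.
LastUse : Vector (Subset m) n → Vector (Subset m) n → Fin n → Fin m → Set
LastUse T M e t =
  ∃ λ s → s Fin.< e × t ∈ T s × (∀ i → s Fin.< i → i Fin.< e → t ∈ M i × t ∉ T i)

-- Trace the tool backward: if the preceding job needs it, the search ends there; otherwise laziness
-- puts it in the state before that job. The trace cannot reach the empty initial magazine.
last-use : ∀ {T M : Vector (Subset m) n} → Lazy T M → ∀ e {t} → t ∈ before M e → LastUse T M e t
last-use {n = suc n} {T} {M} lazy = Fin.<-weakInduction
  (λ e → ∀ {t} → t ∈ before M e → LastUse T M e t)
  (λ t∈⊥ → contradiction t∈⊥ ∉⊥)
  step
  where
  step : ∀ e → (∀ {t} → t ∈ before M (inject₁ e) → LastUse T M (inject₁ e) t) →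
    ∀ {t} → t ∈ M (inject₁ e) → LastUse T M (suc e) t
  step e rec {t} t∈M with t ∈? T (inject₁ e)
  ... | yes t∈T = inject₁ e , inject₁<suc e , t∈T ,
    λ i e<i i<1+e → contradiction (<suc⇒≤inject₁ i<1+e) (<⇒≱ e<i)
  ... | no t∉T with lazy (inject₁ e) t∈M
  ... | inj₁ t∈T = contradiction t∈T t∉T
  ... | inj₂ t∈b with rec t∈b
  ... | s , s<e , t∈Ts , between = s , <-trans s<e (inject₁<suc e) , t∈Ts , λ i s<i i<1+e →
    case Fin.<-cmp i (inject₁ e) of λ where
      (tri< i<e _ _)  → between i s<i i<e
      (tri≈ _ refl _) → t∈M , t∉T
      (tri> _ _ e<i)  → contradiction (<suc⇒≤inject₁ i<1+e) (<⇒≱ e<i)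

module _ {T : Vector (Subset m) n} where

  open Candidate

  start-unique : ∀ {π σ : Pipe m n} → IsPipe T π → IsPipe T σ → tool π ≡ tool σ →
    start σ Fin.< end π → ¬ start π Fin.< start σ
  start-unique π-ok σ-ok refl σ<π π<σ = tool∉inner π-ok _ (π<σ , σ<π) (tool∈start σ-ok)

  end-unique : ∀ {π σ : Pipe m n} → IsPipe T π → IsPipe T σ → tool π ≡ tool σ →
    start σ Fin.< end π → ¬ end π Fin.< end σ
  end-unique π-ok σ-ok refl σ<π π<σ = tool∉inner σ-ok _ (σ<π , π<σ) (tool∈end π-ok)

  -- A pipe joins two successive uses of its tool, so an endpoint of one pipe inside the other would
  -- be a forbidden use. Hence pipes through a common job, or with a common end, are told apart by
  -- their tools.
  overlapping-pipes-equal : ∀ {π σ : Pipe m n} → IsPipe T π → IsPipe T σ → tool π ≡ tool σ →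
    start π Fin.< end σ → start σ Fin.< end π → π ≡ σ
  overlapping-pipes-equal {π} {σ} π-ok σ-ok refl π<σ σ<π
    with Fin.<-cmp (start π) (start σ) | Fin.<-cmp (end π) (end σ)
  ... | tri≈ _ refl _ | tri≈ _ refl _ = refl
  ... | tri< s<s _ _  | _             = contradiction s<s (start-unique π-ok σ-ok refl σ<π)
  ... | tri> _ _ s>s  | _             = contradiction s>s (start-unique σ-ok π-ok refl π<σ)
  ... | _             | tri< e<e _ _  = contradiction e<e (end-unique π-ok σ-ok refl σ<π)
  ... | _             | tri> _ _ e>e  = contradiction e>e (end-unique σ-ok π-ok refl π<σ)

AllPairs-map-All : ∀ {P : A → Set} {R S : A → A → Set} → (∀ {x y} → P x → P y → R x y → S x y) →
  ∀ {xs} → All P xs → AllPairs R xs → AllPairs S xs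
AllPairs-map-All f []         []         = []
AllPairs-map-All f (px ∷ pxs) (rx ∷ rxs) =
  All.zipWith (λ (py , rxy) → f px py rxy) (pxs , rx) ∷ AllPairs-map-All f pxs rxs

¬Candidate-zero : ∀ {T : Vector (Subset m) (suc n)} {π} → ¬ Candidate T zero π
¬Candidate-zero c with refl ← Candidate.ends-at c = contradiction (Candidate.start<end c) n≮0

module _ {T M : Vector (Subset m) n} {e : Fin n} {πs : List (Pipe m n)}
         (enum : Enumerates (Candidate T e) πs) where

  open Candidate

  private
    candidate : ∀ {π} → π List.∈ πs → Candidate T e π
    candidate = Equivalence.to (proj₂ enum _)

  -- Different candidates with the same end overlap and so carry different tools, each of them
  -- needed at `e` and still loaded just before.
  length-contained≤ : T ⊆̇ M → length (filter (contained? M) πs) ≤ ∣ T e ∩ before M e ∣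
  length-contained≤ T⊆M = length≤∣p∣ tool _
    (AllPairs-map-All tool≢ (All.filter⁺ (contained? M) candidates) (AllPairs.filter⁺ (contained? M) (proj₁ enum)))
    (All.zipWith kept (All.filter⁺ (contained? M) candidates , All.all-filter (contained? M) πs))
    where
    candidates : All (Candidate T e) πs
    candidates = All.tabulate candidate
    kept : ∀ {π} → Candidate T e π × Contained M π → tool π ∈ T e ∩ before M e
    kept (c , π⊆M) with refl ← ends-at c = x∈p∩q⁺ (tool∈end c , tool∈before T⊆M c π⊆M e (start<end c) ≤-refl)
    tool≢ : ∀ {π σ} → Candidate T e π → Candidate T e σ → π ≢ σ → tool π ≢ tool σ
    tool≢ {pipe _ _ _} {pipe _ _ _} c d π≢σ t≡t with refl ← ends-at c | refl ← ends-at d =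
      π≢σ (overlapping-pipes-equal c d t≡t (start<end c) (start<end d))

  -- The pipe ending in a given reuse starts at the previous use of the tool, found by `last-use`.
  ≤length-contained : Lazy T M → ∣ T e ∩ before M e ∣ ≤ length (filter (contained? M) πs)
  ≤length-contained lazy = ∣p∣≤length tool _ _ λ {t} t∈ →
    let t∈T , t∈b = x∈p∩q⁻ (T e) _ t∈
        s , s<e , t∈Ts , between = last-use lazy e t∈b
        cand = record { ends-at = refl ; start<end = s<e ; tool∈start = t∈Ts ; tool∈end = t∈T
                      ; tool∉inner = λ i (s<i , i<e) → proj₂ (between i s<i i<e) }
    in pipe s e t
     , List.∈-filter⁺ (contained? M) (Equivalence.from (proj₂ enum _) cand)
         (λ i (s<i , i<e) → proj₁ (between i s<i i<e))
     , refl

length-filter-concat : ∀ {P : A → Set} (P? : ∀ x → Dec (P x)) (xss : Fin n → List A) →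
  length (filter P? (concat (tabulate xss))) ≡ Σ (λ i → length (filter P? (xss i)))
length-filter-concat {n = zero}  P? xss = refl
length-filter-concat {n = suc n} P? xss = trans
  (cong length (filter-++ P? (xss zero) _))
  (trans (length-++ (filter P? (xss zero)))
    (cong (length (filter P? (xss zero)) +_) (length-filter-concat P? (xss ∘ suc))))

-- The reindexing `g` is there because `gpca` loops over `tabulate suc`, all jobs but the first.
foldl-concat-tabulate : ∀ {B : Set} (f : B → A → B) (xss : Fin n → List A) z {k} (g : Fin k → Fin n) →
  foldl (λ z i → foldl f z (xss i)) z (tabulate g) ≡ foldl f z (concat (tabulate (xss ∘ g)))
foldl-concat-tabulate f xss z {zero}  g = refl
foldl-concat-tabulate f xss z {suc k} g =
  trans (foldl-concat-tabulate f xss _ (g ∘ suc)) (sym (foldl-++ f z (xss (g zero)) _))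

-- GPCA: laziness of its result and the lower bound on insertions.

-- Feasibility with fullness weakened to a bound, and with laziness added: the invariant of GPCA and
-- of forward filling, shared by trimmed feasible sequences.
record Partial (T : Vector (Subset m) n) (C : ℕ) (M : Vector (Subset m) n) : Set where
  field
    needed  : T ⊆̇ M
    lazy    : Lazy T M
    bounded : ∀ i → ∣ M i ∣ ≤ C

module _ {m n : ℕ} {T : Vector (Subset m) n} {C : ℕ} where

  open Candidate
  open Partial

  M⊆insertPipe : ∀ (π : Pipe m n) M → M ⊆̇ insertPipe π M
  M⊆insertPipe π M i with inside? π i
  ... | yes in-i rewrite insertPipe-inside π M in-i = p⊆p∪q _
  ... | no ¬in-i rewrite insertPipe-outside π M ¬in-i = id

  insertPipe-contained : ∀ (π : Pipe m n) M → Contained (insertPipe π M) π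
  insertPipe-contained π M i in-i rewrite insertPipe-inside π M in-i = q⊆p∪q (M i) _ (x∈⁅x⁆ _)

  -- Laziness survives because at every inner job the new tool is already present one job earlier,
  -- either through the pipe itself or as a requirement of its start.
  insertPipe-partial : ∀ {π M} → IsPipe T π → HasRoom C M π → Partial T C M → Partial T C (insertPipe π M)
  insertPipe-partial {π} {M} π-ok room M-ok = record
    { needed  = λ i → M⊆insertPipe π M i ∘ needed M-ok i
    ; lazy    = lazy′
    ; bounded = λ i → m+n≤o⇒m≤o _ (insertPipe-load C π M i {0}
        (λ in-i → subst (_≤ C) (sym (+-identityʳ _)) (room i in-i))
        (subst (_≤ C) (sym (+-identityʳ _)) (bounded M-ok i)))
    }
    where
    old : ∀ i {t} → t ∈ M i → t ∈ T i ⊎ t ∈ before (insertPipe π M) i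
    old i = Sum.map₂ (before-mono (M⊆insertPipe π M) i) ∘ lazy M-ok i
    lazy′ : Lazy T (insertPipe π M)
    lazy′ i t∈ with inside? π i
    ... | no ¬in-i = old i (subst (_ ∈_) (insertPipe-outside π M ¬in-i) t∈)
    ... | yes in-i with x∈p∪q⁻ (M i) _ (subst (_ ∈_) (insertPipe-inside π M in-i) t∈)
    ... | inj₁ t∈M = old i t∈M
    ... | inj₂ t∈π with refl ← x∈⁅y⁆⇒x≡y _ t∈π = inj₂ (tool∈before
      (λ i → M⊆insertPipe π M i ∘ needed M-ok i) π-ok (insertPipe-contained π M) i (proj₁ in-i) (<⇒≤ (proj₂ in-i)))

  -- States only grow, so a pipe once accepted is still contained in the final `L`.
  greedy-partial : ∀ {πs q M} → All (IsPipe T) πs → Partial T C M →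
    let q′ , L = foldl (tryPipe C) (q , M) πs in
    Partial T C L × M ⊆̇ L × q′ ≤ q + length (filter (contained? L) πs)
  greedy-partial [] M-ok = M-ok , (λ i → id) , m≤m+n _ _
  greedy-partial {π ∷ πs} {q} {M} (π-ok ∷ πs-ok) M-ok with hasRoom? C M π
  ... | no ¬room rewrite tryPipe-reject {C = C} {q} {M} {π} ¬room =
    let L-ok , M⊆L , q′≤ = greedy-partial πs-ok M-ok in
    L-ok , M⊆L , ≤-trans q′≤ (+-monoʳ-≤ q (length-filter-∷ (contained? _) π πs))
  ... | yes room rewrite tryPipe-accept {C = C} {q} {M} {π} room =
    let L-ok , M⊆L , q′≤ = greedy-partial πs-ok (insertPipe-partial π-ok room M-ok) in
    L-ok , (λ i → M⊆L i ∘ M⊆insertPipe π M i) ,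
    ≤-trans q′≤ (≤-reflexive (trans (sym (+-suc q _)) (cong (q +_) (cong length (sym
      (filter-accept (contained? _) (λ i in-i → M⊆L i (insertPipe-contained π M i in-i))))))))

  module _ {order : Fin n → List (Pipe m n)} (order-ok : GPCAOrder T order) where

    candidates : List (Pipe m n)
    candidates = concat (tabulate order)

    order⇒Candidate : ∀ {e π} → π List.∈ order e → Candidate T e π
    order⇒Candidate = Equivalence.to (proj₂ (order-ok _) _)

    Candidate⇒IsPipe : ∀ {e π} → Candidate T e π → IsPipe T π
    Candidate⇒IsPipe c with refl ← ends-at c = c

    candidates-are-pipes : All (IsPipe T) candidates
    candidates-are-pipes = All.concat⁺
      (All.tabulate⁺ {f = order} λ e → All.tabulate (Candidate⇒IsPipe ∘ order⇒Candidate {e}))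

    -- Any order within a block is harmless, since all its pipes have the same end. Distinctness is
    -- recorded too, for the injectivity of `tool` on pipes through one job.
    candidates-sorted : AllPairs (λ π σ → end π Fin.≤ end σ × π ≢ σ) candidates
    candidates-sorted = AllPairs.concat⁺
      (All.tabulate⁺ λ e → AllPairs-map-All
        (λ c d π≢σ → ≤-reflexive (cong Fin.toℕ (trans (ends-at c) (sym (ends-at d)))) , π≢σ)
        (All.tabulate order⇒Candidate) (proj₁ (order-ok e)))
      (AllPairs.tabulate⁺-< λ e<f → All.tabulate λ π∈ → All.tabulate λ σ∈ →
        let π<σ = subst₂ Fin._<_ (sym (ends-at (order⇒Candidate π∈))) (sym (ends-at (order⇒Candidate σ∈))) e<f
        in <⇒≤ π<σ , λ { refl → <-irrefl refl π<σ })

    gpca≡greedy : gpca T C order ≡ foldl (tryPipe C) (0 , T) candidates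
    gpca≡greedy = go order (λ e → order⇒Candidate)
      where
      go : ∀ {n} {T : Vector (Subset m) n} order → (∀ e {π} → π List.∈ order e → Candidate T e π) →
        gpca T C order ≡ foldl (tryPipe C) (0 , T) (concat (tabulate order))
      go {zero}  order cand = refl
      -- The loop skips the first job, whereas `candidates` includes its block; that block is empty.
      go {suc n} {T} order cand with order zero in eq
      ... | []    = foldl-concat-tabulate (tryPipe C) order (0 , T) suc
      ... | π ∷ _ = contradiction (cand zero (subst (π List.∈_) (sym eq) (here refl))) ¬Candidate-zero

    gpca-partial : (∀ i → ∣ T i ∣ ≤ C) → Partial T C (proj₂ (gpca T C order)) ×
      proj₁ (gpca T C order) ≤ reused T (proj₂ (gpca T C order))
    gpca-partial T≤C rewrite gpca≡greedy =
      let L-ok , _ , q≤ = greedy-partial candidates-are-pipes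
            (record { needed = λ i → id ; lazy = λ i → inj₁ ; bounded = T≤C })
      in L-ok , ≤-trans q≤ (≤-trans
        (≤-reflexive (length-filter-concat (contained? _) order))
        (Σ-mono λ e → length-contained≤ (order-ok e) (needed L-ok)))

    -- The pipes contained in `A` are a rival choice for the greedy algorithm. They fit: those
    -- through job `i` carry distinct tools from `A i ─ T i`, and `A i` respects the capacity.
    reused≤gpca : ∀ {A} → Partial T C A → reused T A ≤ proj₁ (gpca T C order)
    reused≤gpca {A} A-ok rewrite gpca≡greedy = ≤-trans
      (≤-trans
        (Σ-mono λ e → ≤length-contained (order-ok e) (lazy A-ok))
        (≤-reflexive (sym (length-filter-concat (contained? A) order))))
      (greedy-optimal C (AllPairs.map proj₁ candidates-sorted) (filter-⊆ (contained? A) candidates) 0 T fits)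
      where
      kept : List (Pipe m n)
      kept = filter (contained? A) candidates
      fits : Fits C T kept
      fits i = ≤-trans
        (+-monoʳ-≤ ∣ T i ∣ (length≤∣p∣ tool (A i ─ T i)
          (AllPairs-map-All
            (λ (π-ok , _ , π<i , i<π) (σ-ok , _ , σ<i , i<σ) (_ , π≢σ) t≡t →
              π≢σ (overlapping-pipes-equal π-ok σ-ok t≡t (<-trans π<i i<σ) (<-trans σ<i i<π)))
            inside-i (AllPairs.filter⁺ (λ π → inside? π i) (AllPairs.filter⁺ (contained? A) candidates-sorted)))
          (All.map (λ (π-ok , π⊆A , in-i) → x∈p∧x∉q⇒x∈p─q (π⊆A i in-i) (tool∉inner π-ok i in-i)) inside-i)))
        (≤-trans
          (∣p∣+∣q∣≤∣r∣+∣s∣ (T i) (A i ─ T i) (A i) ⊥ (inj₁ ∘ needed A-ok i) (inj₁ ∘ p─q⊆p (A i) (T i))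
            (λ t∈T t∈A─T → contradiction t∈T (∈─⇒∉ (A i) (T i) t∈A─T)))
          (≤-trans (≤-reflexive (∣p∣+∣⊥∣≡∣p∣ (A i))) (bounded A-ok i)))
        where
        inside-i : All (λ π → IsPipe T π × Contained A π × Inside π i) (filter (λ π → inside? π i) kept)
        inside-i = All.zip
          ( All.filter⁺ _ (All.filter⁺ (contained? A) candidates-are-pipes)
          , All.zip (All.filter⁺ _ (All.all-filter (contained? A) candidates) , All.all-filter _ kept))

    -- Compare with `trim T M`: uses it does not carry over are paid for by insertions of `M`, and
    -- uses it does carry over are no more than the pipes counted by GPCA.
    lower-bound : ∀ {M} → T ⊆̇ M → (∀ i → ∣ M i ∣ ≤ C) →
      Σ (λ i → ∣ T i ∣) ≤ insertions M + proj₁ (gpca T C order)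
    lower-bound {M} T⊆M M≤C = ≤-trans (Σ∣T∣≤ T (trim T M))
      (+-mono-≤ (Σ∣T─trim∣≤insertions T M T⊆M) (reused≤gpca record
      { needed  = T⊆trim T M
      ; lazy    = trim-lazy T M
      ; bounded = λ i → ≤-trans (p⊆q⇒∣p∣≤∣q∣ (trim⊆M T M T⊆M i)) (M≤C i)
      }))

-- Filling a state, and one pass of filling over the jobs.

-- Both sides equal the size of `p ∪ q`. For sets of equal size this compares removals with
-- insertions.
∣p─q∣+∣q∣≤∣q─p∣+∣p∣ : ∀ (p q : Subset n) → ∣ p ─ q ∣ + ∣ q ∣ ≤ ∣ q ─ p ∣ + ∣ p ∣
∣p─q∣+∣q∣≤∣q─p∣+∣p∣ p q = ∣p∣+∣q∣≤∣r∣+∣s∣ (p ─ q) q (q ─ p) p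
  (inj₂ ∘ p─q⊆p p q)
  (λ {x} x∈q → case x ∈? p of λ where
    (yes x∈p) → inj₂ x∈p
    (no  x∉p) → inj₁ (x∈p∧x∉q⇒x∈p─q x∈q x∉p))
  (λ x∈p─q x∈q → contradiction x∈q (∈─⇒∉ p q x∈p─q))

⋃-least : ∀ (T : Vector (Subset m) n) {S} → (∀ i → T i ⊆ S) → ⋃ (tabulate T) ⊆ S
⋃-least {n = zero}  T T⊆S x∈⊥ = contradiction x∈⊥ ∉⊥
⋃-least {n = suc n} T T⊆S x∈⋃ = [ T⊆S zero , ⋃-least (T ∘ suc) (T⊆S ∘ suc) ]′ (x∈p∪q⁻ (T zero) _ x∈⋃)

AllPairs-reverse : ∀ {R : A → A → Set} {xs} → AllPairs (flip R) xs → AllPairs R (reverse xs)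
AllPairs-reverse [] = []
AllPairs-reverse {R = R} {x ∷ xs} (rx ∷ rxs) = subst (AllPairs R) (sym (unfold-reverse x xs))
  (AllPairs.++⁺ (AllPairs-reverse rxs) ([] ∷ []) (All.tabulate (λ y∈ → All.lookup rx (Any.reverse⁻ y∈) ∷ [])))

module _ {m n : ℕ} (C : ℕ) where

  -- All that is remembered of the inner loop, whatever its order. Fullness is `C ≤` rather than an
  -- equation so that it persists under growth.
  record Filled (j : Fin n) (xs : List (Fin m)) (M N : Vector (Subset m) n) : Set where
    field
      unchanged : ∀ k → k ≢ j → N k ≡ M k
      grows     : M j ⊆ N j
      added     : ∀ {t} → t ∈ N j → t ∈ M j ⊎ t List.∈ xs
      bounded   : ∣ M j ∣ ≤ C → ∣ N j ∣ ≤ C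
      full      : C ≤ ∣ N j ∣ ⊎ (∀ {t} → t List.∈ xs → t ∈ N j)

  open Filled

  tryTool-add : ∀ j M t → t ∉ M j × ∣ M j ∣ < C → tryTool C j M t ≡ updateAt M j (_∪ ⁅ t ⁆)
  tryTool-add j M t fits = cong {B = Vector (Subset m) n} (λ b → if b then updateAt M j (_∪ ⁅ t ⁆) else M)
    (dec-true (¬? (t ∈? M j) ×-dec (∣ M j ∣ <? C)) fits)

  tryTool-skip : ∀ j M t → ¬ (t ∉ M j × ∣ M j ∣ < C) → tryTool C j M t ≡ M
  tryTool-skip j M t ¬fits = cong {B = Vector (Subset m) n} (λ b → if b then updateAt M j (_∪ ⁅ t ⁆) else M)
    (dec-false (¬? (t ∈? M j) ×-dec (∣ M j ∣ <? C)) ¬fits)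

  Filled-refl : ∀ {j xs M} → C ≤ ∣ M j ∣ ⊎ (∀ {t} → t List.∈ xs → t ∈ M j) → Filled j xs M M
  Filled-refl M-full = record
    { unchanged = λ _ _ → refl ; grows = id ; added = inj₁ ; bounded = id ; full = M-full }

  tryTool-filled : ∀ j M t → Filled j (t ∷ []) M (tryTool C j M t)
  tryTool-filled j M t = go (t ∈? M j) (∣ M j ∣ <? C)
    where
    new : updateAt M j (_∪ ⁅ t ⁆) j ≡ M j ∪ ⁅ t ⁆
    new = updateAt-updates j M

    add : ∣ M j ∣ < C → Filled j (t ∷ []) M (updateAt M j (_∪ ⁅ t ⁆))
    add M<C = record
      { unchanged = λ k k≢j → updateAt-minimal k j M k≢j
      ; grows     = λ x∈M → subst (_ ∈_) (sym new) (p⊆p∪q _ x∈M)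
      ; added     = λ x∈N → Sum.map₂ (here ∘ x∈⁅y⁆⇒x≡y t) (x∈p∪q⁻ (M j) _ (subst (_ ∈_) new x∈N))
      ; bounded   = λ _ → subst (λ S → ∣ S ∣ ≤ C) (sym new) (≤-trans (∣p∪⁅x⁆∣≤1+∣p∣ (M j) t) M<C)
      ; full      = inj₂ λ { (here refl) → subst (_ ∈_) (sym new) (q⊆p∪q (M j) _ (x∈⁅x⁆ t)) }
      }

    go : Dec (t ∈ M j) → Dec (∣ M j ∣ < C) → Filled j (t ∷ []) M (tryTool C j M t)
    go (yes t∈M) _ = subst (Filled j (t ∷ []) M) (sym (tryTool-skip j M t (λ (t∉M , _) → t∉M t∈M)))
      (Filled-refl (inj₂ λ { (here refl) → t∈M }))
    go (no _) (no M≮C) = subst (Filled j (t ∷ []) M) (sym (tryTool-skip j M t (M≮C ∘ proj₂)))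
      (Filled-refl (inj₁ (≮⇒≥ M≮C)))
    go (no t∉M) (yes M<C) = subst (Filled j (t ∷ []) M) (sym (tryTool-add j M t (t∉M , M<C))) (add M<C)

  tryTools-filled : ∀ j xs M → Filled j xs M (foldl (tryTool C j) M xs)
  tryTools-filled j []       M = Filled-refl (inj₂ λ ())
  tryTools-filled j (t ∷ xs) M = record
    { unchanged = λ k k≢j → trans (unchanged rest k k≢j) (unchanged first k k≢j)
    ; grows     = grows rest ∘ grows first
    ; added     = λ x∈N → case added rest x∈N of λ where
        (inj₂ x∈xs) → inj₂ (there x∈xs)
        (inj₁ x∈M′) → Sum.map₂ (λ { (here x≡t) → here x≡t }) (added first x∈M′)
    ; bounded   = bounded rest ∘ bounded first
    ; full      = full′ (full first) (full rest)
    }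
    where
    M′ = tryTool C j M t
    N  = foldl (tryTool C j) M′ xs
    first = tryTool-filled j M t
    rest  = tryTools-filled j xs M′
    full′ : C ≤ ∣ M′ j ∣ ⊎ (∀ {x} → x List.∈ t ∷ [] → x ∈ M′ j) →
            C ≤ ∣ N j ∣ ⊎ (∀ {x} → x List.∈ xs → x ∈ N j) →
            C ≤ ∣ N j ∣ ⊎ (∀ {x} → x List.∈ t ∷ xs → x ∈ N j)
    full′ (inj₁ C≤M′) _           = inj₁ (≤-trans C≤M′ (p⊆q⇒∣p∣≤∣q∣ (grows rest)))
    full′ _           (inj₁ C≤N)  = inj₁ C≤N
    full′ (inj₂ t∈M′) (inj₂ xs⊆N) = inj₂ λ where
      (here x≡t)   → grows rest (t∈M′ (here x≡t))
      (there x∈xs) → xs⊆N x∈xs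

  module _ {fillOrder : Fin n → Fin n → Subset m → List (Fin m)} (fill-ok : FillOrder fillOrder) where

    pass : Vector (Subset m) n → List (Fin n × Fin n) → Vector (Subset m) n
    pass = foldl (λ M (i , j) → foldl (tryTool C j) M (fillOrder i j (M i)))

    -- In `added` and `full` both states of a pair are taken from the final `N`, not from the moment
    -- of processing; laziness and fullness can then be read off `N` directly.
    record Passed (ps : List (Fin n × Fin n)) (M N : Vector (Subset m) n) : Set where
      field
        unchanged : ∀ k → All (λ (_ , j) → k ≢ j) ps → N k ≡ M k
        grows     : M ⊆̇ N
        added     : ∀ k {t} → t ∈ N k → t ∈ M k ⊎ (∃ λ i → (i , k) List.∈ ps × t ∈ N i)
        bounded   : (∀ k → ∣ M k ∣ ≤ C) → ∀ k → ∣ N k ∣ ≤ C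
        full      : ∀ {i j} → (i , j) List.∈ ps → C ≤ ∣ N j ∣ ⊎ N i ⊆ N j

    open Passed

    -- The hypothesis on ps says that the states of a pair are final once the pair
    -- has been processed.
    passed : ∀ {ps} M → All (λ (i , j) → i ≢ j) ps →
      AllPairs (λ (i , j) (_ , j′) → i ≢ j′ × j ≢ j′) ps → Passed ps M (pass M ps)
    passed M [] [] = record
      { unchanged = λ k _ → refl ; grows = λ i → id ; added = λ k → inj₁ ; bounded = id ; full = λ () }
    passed {(i , j) ∷ ps} M (i≢j ∷ distinct) (final ∷ finals) = record
      { unchanged = λ { k (k≢j ∷ k∉ps) → trans (unchanged rest k k∉ps) (Filled.unchanged first k k≢j) }
      ; grows     = λ k → grows rest k ∘ M⊆M′ k
      ; added     = λ k x∈N → case added rest k x∈N of λ where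
          (inj₂ (i , ik∈ps , x∈Ni)) → inj₂ (i , there ik∈ps , x∈Ni)
          (inj₁ x∈M′) → added′ k x∈M′
      ; bounded   = λ M≤C → bounded rest λ k → case k Fin.≟ j of λ where
          (yes refl) → Filled.bounded first (M≤C k)
          (no k≢j)   → subst (λ S → ∣ S ∣ ≤ C) (sym (Filled.unchanged first k k≢j)) (M≤C k)
      ; full      = λ where
          (there ij∈ps) → full rest ij∈ps
          (here refl)   → Sum.map
            (λ C≤M′ → ≤-trans C≤M′ (p⊆q⇒∣p∣≤∣q∣ (grows rest j)))
            (λ Mi⊆M′ x∈Ni → grows rest j (Mi⊆M′ (Equivalence.from (proj₂ (fill-ok i j (M i)) _)
              (subst (_ ∈_) Ni≡Mi x∈Ni))))
            (Filled.full first)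
      }
      where
      first = tryTools-filled j (fillOrder i j (M i)) M
      M′ = foldl (tryTool C j) M (fillOrder i j (M i))
      rest : Passed ps M′ (pass M′ ps)
      rest = passed M′ distinct finals
      Ni≡Mi : pass M′ ps i ≡ M i
      Ni≡Mi = trans (unchanged rest i (All.map proj₁ final)) (Filled.unchanged first i i≢j)
      M⊆M′ : M ⊆̇ M′
      M⊆M′ k with k Fin.≟ j
      ... | yes refl = Filled.grows first
      ... | no k≢j   = λ x∈M → subst (_ ∈_) (sym (Filled.unchanged first k k≢j)) x∈M
      added′ : ∀ k {t} → t ∈ M′ k → t ∈ M k ⊎ (∃ λ i′ → (i′ , k) List.∈ (i , j) ∷ ps × t ∈ pass M′ ps i′)
      added′ k x∈M′ with k Fin.≟ j
      ... | no k≢j   = inj₁ (subst (_ ∈_) (Filled.unchanged first k k≢j) x∈M′)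
      ... | yes refl = Sum.map₂
        (λ x∈ → i , here refl , subst (_ ∈_) (sym Ni≡Mi) (Equivalence.to (proj₂ (fill-ok i j (M i)) _) x∈))
        (Filled.added first x∈M′)

-- The forward and backward lists of consecutive jobs.

inject₁≢suc : ∀ {i j : Fin n} → i Fin.≤ j → inject₁ i ≢ suc j
inject₁≢suc i≤j eq = <⇒≢ (Fin.≤̄⇒inject₁< i≤j) (cong Fin.toℕ eq)

forward : (k : ℕ) → List (Fin (suc k) × Fin (suc k))
forward k = consecutive (suc k)

backward : (k : ℕ) → List (Fin (suc k) × Fin (suc k))
backward k = reverse (map swap (forward k))

∈-forward : ∀ (i : Fin k) → (inject₁ i , suc i) List.∈ forward k
∈-forward i = List.∈-map⁺ _ (List.∈-allFin i)

∈-backward : ∀ (i : Fin k) → (suc i , inject₁ i) List.∈ backward k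
∈-backward i = Any.reverse⁺ (List.∈-map⁺ swap (∈-forward i))

forward⁻ : ∀ {i j : Fin (suc k)} → (i , j) List.∈ forward k → ∃ λ a → i ≡ inject₁ a × j ≡ suc a
forward⁻ ij∈ with a , _ , refl ← List.∈-map⁻ _ ij∈ = a , refl , refl

backward⁻ : ∀ {i j : Fin (suc k)} → (i , j) List.∈ backward k → ∃ λ a → i ≡ suc a × j ≡ inject₁ a
backward⁻ ij∈ with (_ , _) , ji∈ , refl ← List.∈-map⁻ swap (Any.reverse⁻ ij∈) =
  let a , i≡ , j≡ = forward⁻ ji∈ in a , j≡ , i≡

forward-distinct : All (λ (i , j) → i ≢ j) (forward k)
forward-distinct = All.map⁺ (All.tabulate⁺ λ i → inject₁≢suc {i = i} ≤-refl)

backward-distinct : All (λ (i , j) → i ≢ j) (backward k)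
backward-distinct = All.tabulate λ ij∈ → case backward⁻ ij∈ of λ where
  (a , refl , refl) → inject₁≢suc {i = a} ≤-refl ∘ sym

forward-final : AllPairs (λ (i , j) (_ , j′) → i ≢ j′ × j ≢ j′) (forward k)
forward-final = AllPairs.map⁺ (AllPairs.tabulate⁺-< λ i<j →
  inject₁≢suc (<⇒≤ i<j) , λ eq → Fin.<⇒≢ i<j (Fin.suc-injective eq))

backward-final : AllPairs (λ (i , j) (_ , j′) → i ≢ j′ × j ≢ j′) (backward k)
backward-final = AllPairs-reverse (AllPairs.map⁺ (AllPairs.map⁺ (AllPairs.tabulate⁺-< λ i<j →
  inject₁≢suc (<⇒≤ i<j) ∘ sym , λ eq → Fin.<⇒≢ i<j (Fin.inject₁-injective (sym eq)))))

switches≡Σ : ∀ (M : Vector (Subset m) (suc k)) → switches M ≡ Σ (λ i → ∣ M (suc i) ─ M (inject₁ i) ∣)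
switches≡Σ {k = k} M = cong sum (trans (cong (map f) (map-tabulate id g)) (map-tabulate g f))
  where
  f : Fin (suc k) × Fin (suc k) → ℕ
  f (i , j) = ∣ M j ─ M i ∣
  g : Fin k → Fin (suc k) × Fin (suc k)
  g i = inject₁ i , suc i

switches+∣M₀∣≡insertions : ∀ (M : Vector (Subset m) (suc k)) → switches M + ∣ M zero ∣ ≡ insertions M
switches+∣M₀∣≡insertions M = trans (+-comm _ ∣ M zero ∣) (cong₂ _+_ (cong ∣_∣ (sym (p─⊥≡p (M zero)))) (switches≡Σ M))

-- Fullness and cost of the filled sequence.

module _ {m k : ℕ} {T : Vector (Subset m) (suc k)} {C : ℕ} (⋃T≡⊤ : ⋃ (tabulate T) ≡ ⊤) (C<m : C < m)
         {fillOrder : Fin (suc k) → Fin (suc k) → Subset m → List (Fin m)} (fill-ok : FillOrder fillOrder)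
         {L : Vector (Subset m) (suc k)} (L-ok : Partial T C L) where

  open Partial

  private
    N F : Vector (Subset m) (suc k)
    N = pass C fill-ok L (forward k)
    F = pass C fill-ok N (backward k)

    L→N : Passed C fill-ok (forward k) L N
    L→N = passed C fill-ok L forward-distinct forward-final

    N→F : Passed C fill-ok (backward k) N F
    N→F = passed C fill-ok N backward-distinct backward-final

    module L→N = Passed L→N
    module N→F = Passed N→F

  -- Whatever forward filling adds at a job lies in the final state of the preceding job, as
  -- laziness demands.
  N-partial : Partial T C N
  N-partial = record
    { needed  = λ i → L→N.grows i ∘ needed L-ok i
    ; lazy    = λ i t∈N → case L→N.added i t∈N of λ where
        (inj₁ t∈L) → Sum.map₂ (before-mono L→N.grows i) (lazy L-ok i t∈L)
        (inj₂ (j , ji∈ , t∈Nj)) → case forward⁻ ji∈ of λ { (a , refl , refl) → inj₂ t∈Nj }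
    ; bounded = L→N.bounded (bounded L-ok)
    }

  -- As long as no state is full, the forward pass drops nothing and accumulates all requirements so
  -- far; once a state is full, so are all later ones.
  N-full-or-complete : ∀ i → C ≤ ∣ N i ∣ ⊎ (∀ j → j Fin.≤ i → T j ⊆ N i)
  N-full-or-complete = Fin.<-weakInduction _
    (inj₂ λ { zero _ → needed N-partial zero })
    λ i rec → case rec , L→N.full (∈-forward i) of λ where
      (_ , inj₁ C≤N)            → inj₁ C≤N
      (inj₁ C≤N , inj₂ N⊆N)     → inj₁ (≤-trans C≤N (p⊆q⇒∣p∣≤∣q∣ N⊆N))
      (inj₂ T⊆N , inj₂ N⊆N)     → inj₂ λ j j≤1+i {t} t∈T → case j Fin.≟ suc i of λ where
        (yes refl)  → needed N-partial (suc i) t∈T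
        (no j≢1+i)  → N⊆N (T⊆N j (<suc⇒≤inject₁ (Fin.≤∧≢⇒< j≤1+i j≢1+i)) t∈T)

  -- Otherwise the last state would contain all `m` tools, more than the capacity.
  N-last-full : C ≤ ∣ N (fromℕ k) ∣
  N-last-full with N-full-or-complete (fromℕ k)
  ... | inj₁ C≤N = C≤N
  ... | inj₂ T⊆N = contradiction (bounded N-partial (fromℕ k)) (<⇒≱ (<-≤-trans C<m
    (≤-trans (≤-reflexive (sym (∣⊤∣≡n m))) (p⊆q⇒∣p∣≤∣q∣
      (subst (_⊆ N (fromℕ k)) ⋃T≡⊤ (⋃-least T (λ i → T⊆N i (Fin.≤fromℕ i))))))))

  -- Fullness spreads backward from the last job: a state left below capacity would contain its full
  -- successor.
  F-full : ∀ i → ∣ F i ∣ ≡ C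
  F-full i = ≤-antisym (N→F.bounded (bounded N-partial) i) (C≤F i)
    where
    C≤F : ∀ i → C ≤ ∣ F i ∣
    C≤F = Fin.>-weakInduction _
      (≤-trans N-last-full (p⊆q⇒∣p∣≤∣q∣ (N→F.grows (fromℕ k))))
      λ i C≤F → case N→F.full (∈-backward i) of λ where
        (inj₁ C≤F′) → C≤F′
        (inj₂ F⊆F′) → ≤-trans C≤F (p⊆q⇒∣p∣≤∣q∣ F⊆F′)

  -- Filling backward creates no new removals, and between full states there are as
  -- many removals as insertions.
  switches-F : switches F + C ≤ insertions N
  switches-F = begin
    switches F + C                                                                  ≤⟨ +-monoʳ-≤ _ N-last-full ⟩
    switches F + ∣ N (fromℕ k) ∣                                                    ≡⟨ cong (_+ ∣ N (fromℕ k) ∣) (switches≡Σ F) ⟩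
    Σ (λ i → ∣ F (suc i) ─ F (inject₁ i) ∣) + ∣ N (fromℕ k) ∣                       ≤⟨ Σ-telescope _ _ (λ i → ∣ N i ∣) step ⟩
    Σ (λ i → ∣ N (suc i) ─ N (inject₁ i) ∣) + ∣ N zero ∣                            ≡⟨ cong (_+ ∣ N zero ∣) (switches≡Σ N) ⟨
    switches N + ∣ N zero ∣                                                         ≡⟨ switches+∣M₀∣≡insertions N ⟩
    insertions N                                                                    ∎
    where
    open ≤-Reasoning
    removed : ∀ i → F (inject₁ i) ─ F (suc i) ⊆ N (inject₁ i) ─ N (suc i)
    removed i {t} t∈ = x∈p∧x∉q⇒x∈p─q t∈N (t∉F ∘ N→F.grows (suc i))
      where
      t∉F : t ∉ F (suc i)
      t∉F = ∈─⇒∉ (F (inject₁ i)) _ t∈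
      -- A tool added at this job by backward filling is in the next state of `F`, hence not removed
      -- there.
      t∈N : t ∈ N (inject₁ i)
      t∈N with N→F.added (inject₁ i) (p─q⊆p (F (inject₁ i)) _ t∈)
      ... | inj₁ t∈N = t∈N
      ... | inj₂ (_ , ji∈ , t∈Fj) with a , refl , i≡a ← backward⁻ ji∈ with refl ← Fin.inject₁-injective i≡a =
        contradiction t∈Fj t∉F
    -- In `N`, whose states need not be full, removals and insertions differ by the change in size,
    -- so `∣ N i ∣` serves as the potential.
    step : ∀ i → ∣ F (suc i) ─ F (inject₁ i) ∣ + ∣ N (suc i) ∣ ≤ ∣ N (suc i) ─ N (inject₁ i) ∣ + ∣ N (inject₁ i) ∣
    step i = begin
      ∣ F (suc i) ─ F (inject₁ i) ∣ + ∣ N (suc i) ∣             ≤⟨ +-monoˡ-≤ _ (+-cancelʳ-≤ C _ _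
        (subst₂ (λ a b → ∣ F (suc i) ─ F (inject₁ i) ∣ + a ≤ ∣ F (inject₁ i) ─ F (suc i) ∣ + b)
          (F-full (inject₁ i)) (F-full (suc i)) (∣p─q∣+∣q∣≤∣q─p∣+∣p∣ (F (suc i)) (F (inject₁ i))))) ⟩
      ∣ F (inject₁ i) ─ F (suc i) ∣ + ∣ N (suc i) ∣             ≤⟨ +-monoˡ-≤ _ (p⊆q⇒∣p∣≤∣q∣ (removed i)) ⟩
      ∣ N (inject₁ i) ─ N (suc i) ∣ + ∣ N (suc i) ∣             ≤⟨ ∣p─q∣+∣q∣≤∣q─p∣+∣p∣ (N (inject₁ i)) (N (suc i)) ⟩
      ∣ N (suc i) ─ N (inject₁ i) ∣ + ∣ N (inject₁ i) ∣         ∎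

  reused-N : reused T L ≤ reused T N
  reused-N = Σ-mono λ i → p⊆q⇒∣p∣≤∣q∣ λ t∈ →
    let t∈T , t∈b = x∈p∩q⁻ (T i) _ t∈ in x∈p∩q⁺ (t∈T , before-mono L→N.grows i t∈b)

  -- The states of `F` cost no more than the insertions of the lazy sequence `N`, which reuses at
  -- least as much as `L`.
  toFullMag-optimal : Feasible T C (toFullMag C fillOrder L) ×
    switches (toFullMag C fillOrder L) + C + reused T L ≤ Σ (λ i → ∣ T i ∣)
  toFullMag-optimal = subst (λ M → Feasible T C M × switches M + C + reused T L ≤ Σ (λ i → ∣ T i ∣))
    (sym (foldl-++ _ L (forward k) (backward k)))
    ( record { required = λ i → N→F.grows i ∘ needed N-partial i ; full = F-full }
    , ≤-trans (+-mono-≤ switches-F reused-N) (insertions+reused≤ (lazy N-partial)))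

-- The minimum and the optimality of ToFullMag.

-- The minimum has to be attained without any filling order being given, so one is supplied.
ascending : Fin n → Fin n → Subset m → List (Fin m)
ascending {m = m} _ _ S = filter (_∈? S) (allFin m)

ascending-ok : FillOrder (ascending {n} {m})
ascending-ok _ _ S = Unique.filter⁺ (_∈? S) (Unique.allFin⁺ _) , λ t →
  mk⇔ (proj₂ ∘ List.∈-filter⁻ (_∈? S) {xs = allFin _}) (List.∈-filter⁺ (_∈? S) (List.∈-allFin t))

open import Data.Integer.Base as ℤ using (+_; _-_; +≤+)
import Data.Integer.Properties as ℤ
open import Data.Integer.Tactic.RingSolver using (solve-∀)

m+n+o-n-o≡m : ∀ m n o → + (m + n + o) - + n - + o ≡ + m
m+n+o-n-o≡m m n o rewrite ℤ.pos-+ (m + n) o | ℤ.pos-+ m n = lemma (+ m) (+ n) (+ o)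
  where
  lemma : ∀ x y z → x ℤ.+ y ℤ.+ z - y - z ≡ x
  lemma = solve-∀

theorem2 :
    (m n C : ℕ) (T : Vector (Subset m) n) →
    0 < C →
    ⋃ (tabulate T) ≡ ⊤ →
    (∀ i → ∣ T i ∣ ≤ C) →
    C < m →
    (order : Fin n → List (Pipe m n)) → GPCAOrder T order →
    let q = proj₁ (gpca T C order)
        L = proj₂ (gpca T C order)
    in IsMinimum (Feasible T C) switches (+ sum (tabulate (λ i → ∣ T i ∣)) - + C - + q)
       × ((fillOrder : Fin n → Fin n → Subset m → List (Fin m)) → FillOrder fillOrder →
          IsArgmin (Feasible T C) switches (toFullMag C fillOrder L))
-- Without jobs the union is empty, which forces `m` to be zero, against `C < m`.
theorem2 m zero C T _ ⊥≡⊤ _ C<m _ _ =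
  contradiction (trans (sym (∣⊥∣≡0 m)) (trans (cong ∣_∣ ⊥≡⊤) (∣⊤∣≡n m))) (<⇒≢ (≤-<-trans z≤n C<m))
theorem2 m (suc k) C T _ ⋃T≡⊤ T≤C C<m order order-ok =
  ((F ascending , feasible ascending-ok , sym (minimum ascending-ok)) ,
   λ M M-ok → subst (ℤ._≤ + switches M) (sym (minimum ascending-ok)) (+≤+ (optimal ascending-ok M M-ok))) ,
  λ fillOrder fill-ok → feasible fill-ok , optimal fill-ok
  where
  q = proj₁ (gpca T C order)
  L = proj₂ (gpca T C order)
  F = λ fillOrder → toFullMag C fillOrder L
  L-ok = gpca-partial order-ok T≤C

  feasible : ∀ {fillOrder} → FillOrder fillOrder → Feasible T C (F fillOrder)
  feasible fill-ok = proj₁ (toFullMag-optimal ⋃T≡⊤ C<m fill-ok (proj₁ L-ok))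

  upper : ∀ {fillOrder} → FillOrder fillOrder → switches (F fillOrder) + C + q ≤ Σ (λ i → ∣ T i ∣)
  upper fill-ok = ≤-trans (+-monoʳ-≤ _ (proj₂ L-ok))
    (proj₂ (toFullMag-optimal ⋃T≡⊤ C<m fill-ok (proj₁ L-ok)))

  -- The `C` tools of the first state all count as insertions, the rest are switches.
  lower : ∀ M → Feasible T C M → Σ (λ i → ∣ T i ∣) ≤ switches M + C + q
  lower M M-ok = ≤-trans
    (lower-bound order-ok (Feasible.required M-ok) (≤-reflexive ∘ Feasible.full M-ok))
    (≤-reflexive (cong (_+ q) (trans (sym (switches+∣M₀∣≡insertions M))
      (cong (λ c → switches M + c) (Feasible.full M-ok zero)))))

  optimal : ∀ {fillOrder} → FillOrder fillOrder → ∀ M → Feasible T C M → switches (F fillOrder) ≤ switches M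
  optimal fill-ok M M-ok =
    +-cancelʳ-≤ C _ _ (+-cancelʳ-≤ q _ _ (≤-trans (upper fill-ok) (lower M M-ok)))

  minimum : ∀ {fillOrder} → FillOrder fillOrder →
    + Σ (λ i → ∣ T i ∣) - + C - + q ≡ + switches (F fillOrder)
  minimum {fillOrder} fill-ok = trans
    -- The lower bound for the filled sequence itself meets its upper bound.
    (cong (λ s → + s - + C - + q) (≤-antisym (lower _ (feasible fill-ok)) (upper fill-ok)))
    (m+n+o-n-o≡m (switches (F fillOrder)) C q)
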